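{- Let $\Gamma=a_1\Gamma_1+a_2\Gamma_2$ be a gluing of numerical semigroups. Then for every $z\in\mathbb{Z}$, $$\operatorname{Ap}(\Gamma,a_1z)=a_1\operatorname{Ap}(\Gamma_1,z)+a_2\operatorname{Ap}(\Gamma_2,a_1).$$ In particular $\#\operatorname{Ap}(\Gamma,a_1z)= a_1\cdot\#\operatorname{Ap}(\Gamma_1,z)$.
   Context: $\mathbb N$ denotes the non-negative integers. A numerical semigroup is a set $\langle n_1,\dots,n_m\rangle:=n_1\mathbb N+\cdots+n_m\mathbb N$ with $n_i$ positive integers and $\gcd(n_1,\dots,n_m)=1$. The minimal generators of $\Gamma$ are the elements of its unique minimal generating set. For $x\in\mathbb Z$, the Apéry set is $\operatorname{Ap}(\Gamma,x)=\{a\in\Gamma\mid a-x\notin\Gamma\}$. Gluing: given numerical semigroups $\Gamma_1,\Gamma_2$, $a_1\in\Gamma_2$ and $a_2\in\Gamma_1$ with $\gcd(a_1,a_2)=1$, $a_1$ not a minimal generator of $\Gamma_2$ and $a_2$ not a minimal generator of $\Gamma_1$, the numerical semigroup $a_1\Gamma_1+a_2\Gamma_2$ is called a gluing of $\Gamma_1$ and $\Gamma_2$. For sets of integers $X,Y$ and an integer $a$: $aX=\{ax\mid x\in X\}$ and $X+Y=\{x+y\mid x\in X,y\in Y\}$ (empty if either is empty). -}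

module Defs where

open import Level using (0ℓ)
open import Data.Nat as ℕ using (ℕ; NonZero)
import Data.Nat.GCD as ℕ
open import Data.Integer using (ℤ; +_; _+_; _-_; _*_)
open import Data.List using (List; foldr; length)
open import Data.List.Membership.Propositional using () renaming (_∈_ to _∈ˡ_)
open import Data.List.Relation.Binary.Subset.Propositional using () renaming (_⊆_ to _⊆ˡ_)
open import Data.List.Relation.Unary.All using (All)
open import Data.List.Relation.Unary.Unique.Propositional using (Unique)
open import Data.Product using (∃; ∃₂; _×_)
open import Relation.Nullary using (¬_)
open import Relation.Unary using (Pred; _∈_; _∉_; _≐_; ｛_｝)
open import Relation.Binary.PropositionalEquality using (_≡_)

ℤSet : Set₁
ℤSet = Pred ℤ 0ℓ

infixl 6 _⊕_
infixl 7 _⊙_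

_⊙_ : ℤ → ℤSet → ℤSet
(a ⊙ X) z = ∃ λ x → x ∈ X × z ≡ a * x

_⊕_ : ℤSet → ℤSet → ℤSet
(X ⊕ Y) z = ∃₂ λ x y → x ∈ X × y ∈ Y × z ≡ x + y

Naturals : ℤSet
Naturals z = ∃ λ (k : ℕ) → z ≡ + k

⟨_⟩ : List ℕ → ℤSet
⟨_⟩ = foldr (λ n X → + n ⊙ Naturals ⊕ X) ｛ + 0 ｝

-- Since gcd [] = 0, the condition gcds ns ≡ 1 excludes the empty list.
gcds : List ℕ → ℕ
gcds = foldr ℕ.gcd 0

IsNumericalSemigroup : ℤSet → Set
IsNumericalSemigroup Γ = ∃ λ ns → All NonZero ns × gcds ns ≡ 1 × Γ ≐ ⟨ ns ⟩

-- Lists stand for finite sets here: order and multiplicity are irrelevant.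
-- Minimality is with respect to inclusion.
IsMinimalGeneratingSet : List ℕ → ℤSet → Set
IsMinimalGeneratingSet A Γ =
  Γ ≐ ⟨ A ⟩ × (∀ B → B ⊆ˡ A → Γ ≐ ⟨ B ⟩ → A ⊆ˡ B)

IsMinimalGenerator : ℕ → ℤSet → Set
IsMinimalGenerator n Γ = ∃ λ A → IsMinimalGeneratingSet A Γ × n ∈ˡ A

Ap : ℤSet → ℤ → ℤSet
Ap Γ x a = a ∈ Γ × (a - x) ∉ Γ

-- The coefficients are taken in ℕ because numerical semigroups
-- contain no negative integers.
record IsGluing (Γ : ℤSet) (a₁ : ℕ) (Γ₁ : ℤSet) (a₂ : ℕ) (Γ₂ : ℤSet) : Set where
  field
    semigroup₁     : IsNumericalSemigroup Γ₁
    semigroup₂     : IsNumericalSemigroup Γ₂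
    a₁∈Γ₂          : + a₁ ∈ Γ₂
    a₂∈Γ₁          : + a₂ ∈ Γ₁
    gcd≡1          : ℕ.gcd a₁ a₂ ≡ 1
    a₁-not-minimal : ¬ IsMinimalGenerator a₁ Γ₂
    a₂-not-minimal : ¬ IsMinimalGenerator a₂ Γ₁
    Γ≐             : Γ ≐ + a₁ ⊙ Γ₁ ⊕ + a₂ ⊙ Γ₂

-- X is finite with exactly n elements.
HasCardinality : ℤSet → ℕ → Set
HasCardinality X n = ∃ λ xs → Unique xs × X ≐ (_∈ˡ xs) × length xs ≡ n

{-# OPTIONS --safe #-}
module Submission where

-- Reducing the Γ₂-part of an element of Γ modulo a₁ moves multiples of a₁ a₂
-- into a₁ Γ₁, so the Γ₂-part may be taken in Ap(Γ₂, a₁). Since gcd(a₁, a₂) = 1,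
-- two representations a₁ x + a₂ y of the same integer have Γ₂-parts congruent
-- modulo a₁, and w ∈ Ap(Γ₂, a₁) is the least element of Γ₂ in its residue class;
-- hence a₁ x + a₂ w - a₁ z ∈ Γ iff x - z ∈ Γ₁. The same congruence shows that
-- (x, w) ↦ a₁ x + a₂ w is injective on Ap(Γ₁, z) × Ap(Γ₂, a₁), and Ap(Γ₂, a₁)
-- has one element for each residue class modulo a₁.

open import Defs
open import Data.Nat using (ℕ)
import Data.Nat as ℕ
open import Data.Integer using (ℤ; +_; _*_)
open import Data.Product using (∃; _×_)
open import Relation.Unary using (_≐_)

open import Data.Fin using (Fin; toℕ; fromℕ<)
open import Data.Fin.Properties using (toℕ<n; toℕ-fromℕ<; toℕ-injective)
open import Data.Integer using (-[1+_]; _+_; _-_; -_; ∣_∣; _≟_)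
open import Data.Integer.Coprimality using (coprime-divisor)
open import Data.Integer.Divisibility.Signed using (_∣_; divides; ∣ᵤ⇒∣; ∣⇒∣ᵤ; ∣m∣n⇒∣m+n; ∣m∣n⇒∣m-n)
import Data.Integer.Properties as ℤ
open import Algebra.Properties.AbelianGroup ℤ.+-0-abelianGroup using () renaming (∙-cancelʳ to +-cancelʳ)
open import Data.Integer.Tactic.RingSolver using (solve-∀)
open import Data.List using (List; []; _∷_; map; filter; upTo; allFin; length; cartesianProductWith)
open import Data.List.Membership.Propositional using () renaming (_∈_ to _∈ˡ_)
open import Data.List.Membership.Propositional.Properties
  using (∈-map⁺; ∈-filter⁺; ∈-filter⁻; ∈-upTo⁺; ∈-allFin; ∈-cartesianProductWith⁺; ∈-cartesianProductWith⁻)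
open import Data.List.Properties using (length-map; length-++; length-tabulate)
open import Data.List.Relation.Unary.All using (All; []; _∷_)
open import Data.List.Relation.Unary.Any using (here; there)
open import Data.List.Relation.Unary.Unique.Propositional using (Unique)
import Data.List.Relation.Unary.Unique.Propositional.Properties as Unique
import Data.Nat.Coprimality as Coprimality
import Data.Nat.Divisibility as ℕ using (>⇒∤)
open import Data.Nat.DivMod using (_/_; _%_; m≡m%n+[m/n]*n; m%n<n; /-monoˡ-≤; m*n/n≡m)
open import Data.Nat.GCD using (gcd; module Bézout; gcd-GCD)
open import Data.Nat.Induction using (<-rec)
import Data.Nat.Properties as ℕ
open import Data.Product using (_,_; proj₁; proj₂)
open import Function using (_∘_; id)
open import Relation.Binary.PropositionalEquality
open import Relation.Nullary using (yes; no; ¬?; _×-dec_; contradiction)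
import Relation.Nullary.Decidable as Dec
open import Relation.Unary using (Decidable; _∈_; _∉_; _⊆_)

-- Cofinite submonoids of the natural numbers

-- What the Apéry arguments use of a numerical semigroup, with the generators forgotten. The
-- `conductor` may be any bound on the gaps, not only the least one.
record IsCofiniteSubmonoid (S : ℤSet) : Set where
  field
    0∈        : + 0 ∈ S
    +-closed  : ∀ {x y} → x ∈ S → y ∈ S → x + y ∈ S
    ⊆Naturals : S ⊆ Naturals
    _∈?       : Decidable S
    conductor : ℕ
    beyond    : ∀ m → conductor ℕ.≤ m → + m ∈ S

  *-closed : ∀ k {x} → x ∈ S → + k * x ∈ S
  *-closed ℕ.zero    {x} _   = subst S (sym (ℤ.*-zeroˡ x)) 0∈
  *-closed (ℕ.suc k) {x} x∈S =
    subst S (sym (ℤ.suc-* (+ k) x)) (+-closed x∈S (*-closed k x∈S))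

-- Finitely generated submonoids

⟨∷⟩⁺ : ∀ n ns k {y} → y ∈ ⟨ ns ⟩ → + n * + k + y ∈ ⟨ n ∷ ns ⟩
⟨∷⟩⁺ n ns k {y} y∈ = _ , y , (+ k , (k , refl) , refl) , y∈ , refl

⟨⟩-0∈ : ∀ ns → + 0 ∈ ⟨ ns ⟩
⟨⟩-0∈ []       = refl
⟨⟩-0∈ (n ∷ ns) = subst ⟨ n ∷ ns ⟩ (zero-combination (+ n)) (⟨∷⟩⁺ n ns 0 (⟨⟩-0∈ ns))
  where
  zero-combination : ∀ n → n * + 0 + + 0 ≡ + 0
  zero-combination = solve-∀

⟨⟩-+-closed : ∀ ns {x y} → x ∈ ⟨ ns ⟩ → y ∈ ⟨ ns ⟩ → x + y ∈ ⟨ ns ⟩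
⟨⟩-+-closed []       refl refl = refl
⟨⟩-+-closed (n ∷ ns) (_ , x , (_ , (k , refl) , refl) , x∈ , refl)
                     (_ , y , (_ , (l , refl) , refl) , y∈ , refl) =
  subst ⟨ n ∷ ns ⟩ (rearrange (+ n) (+ k) (+ l) x y)
    (⟨∷⟩⁺ n ns (k ℕ.+ l) (⟨⟩-+-closed ns x∈ y∈))
  where
  rearrange : ∀ n k l x y → n * (k + l) + (x + y) ≡ n * k + x + (n * l + y)
  rearrange = solve-∀

⟨⟩-*-closed : ∀ ns k {x} → x ∈ ⟨ ns ⟩ → + k * x ∈ ⟨ ns ⟩
⟨⟩-*-closed ns ℕ.zero    {x} _  = subst ⟨ ns ⟩ (sym (ℤ.*-zeroˡ x)) (⟨⟩-0∈ ns)
⟨⟩-*-closed ns (ℕ.suc k) {x} x∈ =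
  subst ⟨ ns ⟩ (sym (ℤ.suc-* (+ k) x)) (⟨⟩-+-closed ns x∈ (⟨⟩-*-closed ns k x∈))

⟨⟩⊆Naturals : ∀ ns → ⟨ ns ⟩ ⊆ Naturals
⟨⟩⊆Naturals []       refl = 0 , refl
⟨⟩⊆Naturals (n ∷ ns) (_ , y , (_ , (k , refl) , refl) , y∈ , refl)
  with l , refl ← ⟨⟩⊆Naturals ns y∈ = n ℕ.* k ℕ.+ l , cong (_+ + l) (sym (ℤ.pos-* n k))

-- Since `n` is positive and the remaining summand is nonnegative, the coefficient of `n` in a
-- representation of `z` is at most `∣ z ∣`, so a bounded search decides membership.
⟨⟩-dec : ∀ ns → All ℕ.NonZero ns → Decidable ⟨ ns ⟩
⟨⟩-dec []       []           z = + 0 ≟ z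
⟨⟩-dec (n ∷ ns) (n≢0 ∷ ns≢0) z =
  Dec.map′ to from (ℕ.anyUpTo? (λ k → ⟨⟩-dec ns ns≢0 (z - + n * + k)) (ℕ.suc ∣ z ∣))
  where
  cancel : ∀ a z → a + (z - a) ≡ z
  cancel = solve-∀
  cancel′ : ∀ a y → y ≡ a + y - a
  cancel′ = solve-∀
  to : (∃ λ k → k ℕ.< ℕ.suc ∣ z ∣ × z - + n * + k ∈ ⟨ ns ⟩) → z ∈ ⟨ n ∷ ns ⟩
  to (k , _ , r∈) = subst ⟨ n ∷ ns ⟩ (cancel (+ n * + k) z) (⟨∷⟩⁺ n ns k r∈)
  from : z ∈ ⟨ n ∷ ns ⟩ → ∃ λ k → k ℕ.< ℕ.suc ∣ z ∣ × z - + n * + k ∈ ⟨ ns ⟩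
  from (_ , y , (_ , (k , refl) , refl) , y∈ , refl) =
    k , ℕ.s≤s k≤∣z∣ , subst ⟨ ns ⟩ (cancel′ (+ n * + k) y) y∈
    where
    k≤∣z∣ : k ℕ.≤ ∣ + n * + k + y ∣
    k≤∣z∣ with l , refl ← ⟨⟩⊆Naturals ns y∈ rewrite sym (ℤ.pos-* n k) =
      ℕ.≤-trans (ℕ.m≤n*m k n {{n≢0}}) (ℕ.m≤m+n (n ℕ.* k) l)

-- The positive and the negative part of a Bézout combination of the generators.
⟨⟩-gcd-apart : ∀ ns → ∃ λ v → v ∈ ⟨ ns ⟩ × v + + gcds ns ∈ ⟨ ns ⟩
⟨⟩-gcd-apart []       = + 0 , refl , refl
⟨⟩-gcd-apart (n ∷ ns) with ⟨⟩-gcd-apart ns | Bézout.identity (gcd-GCD n (gcds ns))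
-- From `d + y * g ≡ x * n` follows `y * (v + g) + d ≡ n * x + y * v`: adding `y * v` on both sides
-- avoids the subtraction. For the opposite signs the two elements exchange roles.
... | v , v∈ , u∈ | Bézout.Identity.+- x y eq =
  + 0 + + y * (v + + g) , y*u∈ ,
  subst ⟨ n ∷ ns ⟩ shift (⟨∷⟩⁺ n ns x (⟨⟩-*-closed ns y v∈))
  where
  g = gcds ns
  d = gcds (n ∷ ns)
  y*u∈ : + 0 + + y * (v + + g) ∈ ⟨ n ∷ ns ⟩
  y*u∈ = subst (λ t → t + + y * (v + + g) ∈ ⟨ n ∷ ns ⟩) (ℤ.*-zeroʳ (+ n))
    (⟨∷⟩⁺ n ns 0 (⟨⟩-*-closed ns y u∈))
  eqℤ : + d + + y * + g ≡ + x * + n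
  eqℤ = trans (cong (_+_ (+ d)) (sym (ℤ.pos-* y g))) (trans (cong +_ eq) (ℤ.pos-* x n))
  e₁ : ∀ n x yv → n * x + yv ≡ x * n + yv
  e₁ = solve-∀
  e₂ : ∀ d y g v → d + y * g + y * v ≡ + 0 + y * (v + g) + d
  e₂ = solve-∀
  shift : + n * + x + + y * v ≡ + 0 + + y * (v + + g) + + d
  shift = trans (e₁ (+ n) (+ x) (+ y * v))
    (trans (cong (_+ + y * v) (sym eqℤ)) (e₂ (+ d) (+ y) (+ g) v))
... | v , v∈ , u∈ | Bézout.Identity.-+ x y eq =
  + n * + x + + y * v , ⟨∷⟩⁺ n ns x (⟨⟩-*-closed ns y v∈) ,
  subst ⟨ n ∷ ns ⟩ shift (⟨∷⟩⁺ n ns 0 (⟨⟩-*-closed ns y u∈))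
  where
  g = gcds ns
  d = gcds (n ∷ ns)
  eqℤ : + d + + x * + n ≡ + y * + g
  eqℤ = trans (cong (_+_ (+ d)) (sym (ℤ.pos-* x n))) (trans (cong +_ eq) (ℤ.pos-* y g))
  e₁ : ∀ n y v g → n * + 0 + y * (v + g) ≡ y * g + y * v
  e₁ = solve-∀
  e₂ : ∀ d n x yv → d + x * n + yv ≡ n * x + yv + d
  e₂ = solve-∀
  shift : + n * + 0 + + y * (v + + g) ≡ + n * + x + + y * v + + d
  shift = trans (e₁ (+ n) (+ y) v (+ g))
    (trans (cong (_+ + y * v) (sym eqℤ)) (e₂ (+ d) (+ n) (+ x) (+ y * v)))

-- With m = r + q v and r < v ≤ q one has m = (q - r) v + r (v + 1).
⟨⟩-consecutive⇒cofinite : ∀ ns v → + v ∈ ⟨ ns ⟩ → + v + + 1 ∈ ⟨ ns ⟩ →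
  ∀ m → v ℕ.* v ℕ.≤ m → + m ∈ ⟨ ns ⟩
⟨⟩-consecutive⇒cofinite ns ℕ.zero      _  1∈ m _ =
  subst ⟨ ns ⟩ (ℤ.*-identityʳ (+ m)) (⟨⟩-*-closed ns m 1∈)
⟨⟩-consecutive⇒cofinite ns v@(ℕ.suc _) v∈ u∈ m v²≤m =
  subst ⟨ ns ⟩ split (⟨⟩-+-closed ns (⟨⟩-*-closed ns e v∈) (⟨⟩-*-closed ns r u∈))
  where
  r = m % v
  q = m / v
  e = q ℕ.∸ r
  v≤q : v ℕ.≤ q
  v≤q = subst (ℕ._≤ q) (m*n/n≡m v v) (/-monoˡ-≤ v v²≤m)
  q≡ : e ℕ.+ r ≡ q
  q≡ = ℕ.m∸n+n≡m (ℕ.≤-trans (ℕ.<⇒≤ (m%n<n m v)) v≤q)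
  expand : ∀ e r v → e * v + r * (v + + 1) ≡ r + (e + r) * v
  expand = solve-∀
  split : + e * + v + + r * (+ v + + 1) ≡ + m
  split = begin
    + e * + v + + r * (+ v + + 1) ≡⟨ expand (+ e) (+ r) (+ v) ⟩
    + r + + (e ℕ.+ r) * + v       ≡⟨ cong (λ t → + r + + t * + v) q≡ ⟩
    + r + + q * + v               ≡⟨ cong (_+_ (+ r)) (sym (ℤ.pos-* q v)) ⟩
    + (r ℕ.+ q ℕ.* v)             ≡⟨ cong +_ (sym (m≡m%n+[m/n]*n m v)) ⟩
    + m                           ∎
    where open ≡-Reasoning

-- With gcd 1, `⟨⟩-gcd-apart` supplies two consecutive elements `k` and `k + 1`, and these already
-- generate everything from `k * k` on.
numerical⇒cofinite : ∀ {S} → IsNumericalSemigroup S → IsCofiniteSubmonoid S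
numerical⇒cofinite {S} (ns , ns≢0 , gcd≡1 , S⊆ , ⊆S)
  with v , v∈ , u∈ ← ⟨⟩-gcd-apart ns
  with k , refl ← ⟨⟩⊆Naturals ns v∈ = record
  { 0∈        = ⊆S (⟨⟩-0∈ ns)
  ; +-closed  = λ x∈ y∈ → ⊆S (⟨⟩-+-closed ns (S⊆ x∈) (S⊆ y∈))
  ; ⊆Naturals = ⟨⟩⊆Naturals ns ∘ S⊆
  ; _∈?       = λ z → Dec.map′ ⊆S S⊆ (⟨⟩-dec ns ns≢0 z)
  ; conductor = k ℕ.* k
  ; beyond    = λ m k²≤m → ⊆S (⟨⟩-consecutive⇒cofinite ns k v∈
                  (subst (λ g → + k + + g ∈ ⟨ ns ⟩) gcd≡1 u∈) m k²≤m)
  }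

-- The list `1 ∷ []` generates all naturals, whereas the empty list generates only `0` and so misses
-- `1`.
1-minimalGenerator : ∀ {S} → IsCofiniteSubmonoid S → + 1 ∈ S → IsMinimalGenerator 1 S
1-minimalGenerator {S} isS 1∈S = 1 ∷ [] , ((S⊆ , ⊆S) , minimal) , here refl
  where
  open IsCofiniteSubmonoid isS using (*-closed; ⊆Naturals)
  tidy : ∀ k → + 1 * k + + 0 ≡ k
  tidy = solve-∀
  tidy′ : ∀ k → k * + 1 ≡ + 1 * k + + 0
  tidy′ = solve-∀
  S⊆ : S ⊆ ⟨ 1 ∷ [] ⟩
  S⊆ x∈ with k , refl ← ⊆Naturals x∈ =
    subst ⟨ 1 ∷ [] ⟩ (tidy (+ k)) (⟨∷⟩⁺ 1 [] k refl)
  ⊆S : ⟨ 1 ∷ [] ⟩ ⊆ S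
  ⊆S (_ , _ , (_ , (k , refl) , refl) , refl , refl) =
    subst S (tidy′ (+ k)) (*-closed k 1∈S)
  minimal : ∀ B → (∀ {x} → x ∈ˡ B → x ∈ˡ 1 ∷ []) → S ≐ ⟨ B ⟩ →
            ∀ {x} → x ∈ˡ 1 ∷ [] → x ∈ˡ B
  minimal []      _  (S⊆⟨⟩ , _) (here refl) with () ← S⊆⟨⟩ 1∈S
  minimal (b ∷ B) B⊆ _          (here refl) with B⊆ (here refl)
  ... | here refl = here refl

-- Apéry sets

-- If `m` is at least `conductor + ∣ z ∣`, then `m - z` is past the conductor and lies in `S`. Hence
-- filtering the naturals below this bound lists the whole Apéry set.
Ap-finite : ∀ {S} → IsCofiniteSubmonoid S → ∀ z → ∃ λ n → HasCardinality (Ap S z) n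
Ap-finite {S} isS z =
  length xs , xs , Unique.filter⁺ Ap? (Unique.map⁺ ℤ.+-injective (Unique.upTo⁺ bound)) ,
  (to , λ x∈ → proj₂ (∈-filter⁻ Ap? {xs = map +_ (upTo bound)} x∈)) , refl
  where
  open IsCofiniteSubmonoid isS
  Ap? : Decidable (Ap S z)
  Ap? x = (x ∈?) ×-dec ¬? ((x - z) ∈?)
  bound = conductor ℕ.+ ∣ z ∣
  xs = filter Ap? (map +_ (upTo bound))
  far : ∀ m z → conductor ℕ.+ ∣ z ∣ ℕ.≤ m → + m - z ∈ S
  far m (+ k)    c≤m = subst S (sym (trans (ℤ.m-n≡m⊖n m k) (ℤ.⊖-≥ (ℕ.m+n≤o⇒n≤o conductor c≤m))))
    (beyond (m ℕ.∸ k) (ℕ.m+n≤o⇒m≤o∸n conductor c≤m))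
  far m -[1+ k ] c≤m = beyond (m ℕ.+ ℕ.suc k)
    (ℕ.≤-trans (ℕ.m+n≤o⇒m≤o conductor c≤m) (ℕ.m≤m+n m _))
  to : Ap S z ⊆ (_∈ˡ xs)
  to x∈@(x∈S , x-z∉S) with m , refl ← ⊆Naturals x∈S with m ℕ.<? bound
  ... | yes m<b = ∈-filter⁺ Ap? (∈-map⁺ +_ (∈-upTo⁺ m<b)) x∈
  ... | no  m≮b = contradiction (far m z (ℕ.≮⇒≥ m≮b)) x-z∉S

-- An enumeration of `Ap S (+ a)` by `Fin a`. Its members are required to be incongruent modulo `a`,
-- not merely distinct, because comparing two representations yields a congruence.
ApResidueSystem : ℤSet → ℕ → Set
ApResidueSystem S a = ∃ λ (w : Fin a → ℤ) →
  (∀ i → w i ∈ Ap S (+ a)) ×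
  (∀ {i j} → + a ∣ w i - w j → i ≡ j) ×
  (∀ {y} → y ∈ Ap S (+ a) → ∃ λ i → y ≡ w i)

∣-<⇒≡ : ∀ {a i j} → i ℕ.< a → j ℕ.< a → + a ∣ + i - + j → i ≡ j
∣-<⇒≡ {a} {i} {j} i<a j<a a∣ with ∣ + i - + j ∣ in eq | ∣⇒∣ᵤ a∣
... | ℕ.zero  | _  = ℤ.+-injective (ℤ.i-j≡0⇒i≡j (+ i) (+ j) (ℤ.∣i∣≡0⇒i≡0 eq))
... | ℕ.suc d | a∣d = contradiction a∣d (ℕ.>⇒∤ (subst (ℕ._< a) eq ∣i-j∣<a))
  where
  ∣i-j∣<a : ∣ + i - + j ∣ ℕ.< a
  ∣i-j∣<a = subst (λ d → ∣ d ∣ ℕ.< a) (sym (ℤ.m-n≡m⊖n i j))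
    (ℕ.≤-<-trans (ℤ.∣m⊝n∣≤m⊔n i j) (ℕ.⊔-lub i<a j<a))

-k*a⇒+k*a : ∀ w t k a → w - t ≡ - + k * + a → t ≡ w + + k * + a
-k*a⇒+k*a w t k a eq =
  trans (double-minus w t) (trans (cong (_-_ w) eq) (sign-change w (+ k) (+ a)))
  where
  double-minus : ∀ w t → t ≡ w - (w - t)
  double-minus = solve-∀
  sign-change : ∀ w k a → w - - k * a ≡ w + k * a
  sign-change = solve-∀

module _ {S : ℤSet} (isS : IsCofiniteSubmonoid S) (a : ℕ) {{_ : ℕ.NonZero a}} where
  open IsCofiniteSubmonoid isS

  -- Descent: subtract `a` as long as the result stays in `S`. Membership is decidable, and the
  -- descent ends because `a` is positive.
  Ap-decompose : ∀ {t} → t ∈ S → ∃ λ w → w ∈ Ap S (+ a) × ∃ λ k → t ≡ w + + k * + a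
  Ap-decompose t∈ with m , refl ← ⊆Naturals t∈ = <-rec P step m t∈
    where
    P : ℕ → Set
    P m = + m ∈ S → ∃ λ w → w ∈ Ap S (+ a) × ∃ λ k → + m ≡ w + + k * + a
    no-shift : ∀ m a → m ≡ m + + 0 * a
    no-shift = solve-∀
    restore : ∀ m a → m ≡ m - a + a
    restore = solve-∀
    regroup : ∀ w k a → w + k * a + a ≡ w + (+ 1 + k) * a
    regroup = solve-∀
    step : ∀ m → (∀ {l} → l ℕ.< m → P l) → P m
    step m rec m∈ with (+ m - + a) ∈?
    ... | no  ∉S = + m , (m∈ , ∉S) , 0 , no-shift (+ m) (+ a)
    ... | yes ∈S with l , eq ← ⊆Naturals ∈S
      with m≡l+a ← trans (restore (+ m) (+ a)) (cong (_+ + a) eq)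
      with w , w∈ , k , l≡ ← rec (subst (l ℕ.<_) (sym (ℤ.+-injective m≡l+a)) (ℕ.m<m+n l (ℕ.>-nonZero⁻¹ a))) (subst S eq ∈S)
      = w , w∈ , ℕ.suc k , trans m≡l+a (trans (cong (_+ + a) l≡) (regroup w (+ k) (+ a)))

  module _ (a∈S : + a ∈ S) where

    -- If `w - t` were a positive multiple of `a`, then `w - a` would be `t` plus a nonnegative
    -- multiple of `a`, hence in `S`.
    Ap-least : ∀ {w t} → w ∈ Ap S (+ a) → t ∈ S → + a ∣ w - t → ∃ λ k → t ≡ w + + k * + a
    Ap-least {w} {t} (_ , w-a∉S) t∈ (divides (+ ℕ.suc k) eq) =
      contradiction (subst S (sym shift) (+-closed t∈ (*-closed k a∈S))) w-a∉S
      where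
      insert : ∀ w t a → w - a ≡ t + (w - t - a)
      insert = solve-∀
      drop-one : ∀ t k a → t + ((+ 1 + k) * a - a) ≡ t + k * a
      drop-one = solve-∀
      shift : w - + a ≡ t + + k * + a
      shift = trans (insert w t (+ a))
        (trans (cong (λ d → t + (d - + a)) eq) (drop-one t (+ k) (+ a)))
    Ap-least {w} {t} _ _ (divides (+ ℕ.zero) eq) = 0 , -k*a⇒+k*a w t 0 a eq
    Ap-least {w} {t} _ _ (divides -[1+ k ] eq) = ℕ.suc k , -k*a⇒+k*a w t (ℕ.suc k) a eq

    -- By `Ap-least`, `w′` is `w` plus `k` times `a`; a positive `k` would put `w′ - a` in `S`.
    Ap-unique : ∀ {w w′} → w ∈ Ap S (+ a) → w′ ∈ Ap S (+ a) → + a ∣ w - w′ → w ≡ w′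
    Ap-unique {w} w∈ (w′∈S , w′-a∉S) a∣ with Ap-least w∈ w′∈S a∣
    ... | ℕ.zero  , refl = no-shift w (+ a)
      where
      no-shift : ∀ w a → w ≡ w + + 0 * a
      no-shift = solve-∀
    ... | ℕ.suc k , refl =
      contradiction (subst S (drop-one w (+ k) (+ a)) (+-closed (proj₁ w∈) (*-closed k a∈S))) w′-a∉S
      where
      drop-one : ∀ w k a → w + k * a ≡ w + (+ 1 + k) * a - a
      drop-one = solve-∀

  Ap-representative : ∀ i → ∃ λ w → w ∈ Ap S (+ a) × + a ∣ w - + i
  Ap-representative i
    -- The number `i + conductor * a` is congruent to `i` and, as `a` is positive, past the
    -- conductor; reducing it gives the representative.
    with w , w∈ , k , eq ← Ap-decompose (beyond (i ℕ.+ conductor ℕ.* a)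
           (ℕ.≤-trans (ℕ.m≤m*n conductor a) (ℕ.m≤n+m _ i)))
    = w , w∈ , divides (+ conductor - + k) w-i≡
    where
    isolate : ∀ w i k a → w - i ≡ (w + k * a) - i - k * a
    isolate = solve-∀
    collect : ∀ i c k a → (i + c * a) - i - k * a ≡ (c - k) * a
    collect = solve-∀
    w-i≡ : w - + i ≡ (+ conductor - + k) * + a
    w-i≡ = trans (isolate w (+ i) (+ k) (+ a))
      (trans (cong (λ t → t - + i - + k * + a)
        (trans (sym eq) (cong (_+_ (+ i)) (ℤ.pos-* conductor a))))
        (collect (+ i) (+ conductor) (+ k) (+ a)))

  Ap-residues : + a ∈ S → ApResidueSystem S a
  Ap-residues a∈S = w , w∈ , w-injective , w-surjective
    where
    rep = λ (i : Fin a) → Ap-representative (toℕ i)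
    w = λ i → proj₁ (rep i)
    w∈ = λ i → proj₁ (proj₂ (rep i))
    a∣w-i = λ i → proj₂ (proj₂ (rep i))

    -- Each `w i` is congruent to `i`, so `a` divides `i - j`, whose absolute value is below `a`.
    w-injective : ∀ {i j} → + a ∣ w i - w j → i ≡ j
    w-injective {i} {j} a∣ = toℕ-injective (∣-<⇒≡ (toℕ<n i) (toℕ<n j)
      (subst (+ a ∣_) (telescope (w i) (w j) (+ toℕ i) (+ toℕ j))
        (∣m∣n⇒∣m+n (∣m∣n⇒∣m-n a∣ (a∣w-i i)) (a∣w-i j))))
      where
      telescope : ∀ v w i j → v - w - (v - i) + (w - j) ≡ i - j
      telescope = solve-∀

    w-surjective : ∀ {y} → y ∈ Ap S (+ a) → ∃ λ i → y ≡ w i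
    -- The index is the remainder of `m` modulo `a`; its representative is congruent to `m`, hence
    -- equal to it.
    w-surjective y∈ with m , refl ← ⊆Naturals (proj₁ y∈) =
      i , Ap-unique a∈S y∈ (w∈ i)
        (subst (+ a ∣_) (telescope (+ m) (w i) (+ toℕ i))
          (∣m∣n⇒∣m-n (divides (+ (m / a)) m-i≡) (a∣w-i i)))
      where
      i = fromℕ< (m%n<n m a)
      telescope : ∀ m w i → m - i - (w - i) ≡ m - w
      telescope = solve-∀
      cancel : ∀ i q → i + q - i ≡ q
      cancel = solve-∀
      m-i≡ : + m - + toℕ i ≡ + (m / a) * + a
      m-i≡ = begin
        + m - + toℕ i                            ≡⟨ cong₂ (λ m i → + m - + i) (m≡m%n+[m/n]*n m a) (toℕ-fromℕ< (m%n<n m a)) ⟩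
        + (m % a) + + (m / a ℕ.* a) - + (m % a)  ≡⟨ cancel (+ (m % a)) (+ (m / a ℕ.* a)) ⟩
        + (m / a ℕ.* a)                          ≡⟨ ℤ.pos-* (m / a) a ⟩
        + (m / a) * + a                          ∎
        where open ≡-Reasoning

-- Gluings

-- The equation gives `b * (y - y′) ≡ (x′ - x) * a`, and `a` is coprime to `b`.
combination-≡⇒∣ : ∀ {a b} → gcd a b ≡ 1 → ∀ {x x′ y y′} →
  + a * x + + b * y ≡ + a * x′ + + b * y′ → + a ∣ y - y′
combination-≡⇒∣ {a} {b} gcd≡1 {x} {x′} {y} {y′} eq =
  ∣ᵤ⇒∣ (coprime-divisor (+ a) (+ b) (y - y′) (Coprimality.gcd≡1⇒coprime gcd≡1)
    (∣⇒∣ᵤ (divides (x′ - x) b[y-y′]≡)))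
  where
  isolate : ∀ a b x y y′ → b * (y - y′) ≡ a * x + b * y - a * x - b * y′
  isolate = solve-∀
  collect : ∀ a b x x′ y′ → a * x′ + b * y′ - a * x - b * y′ ≡ (x′ - x) * a
  collect = solve-∀
  b[y-y′]≡ : + b * (y - y′) ≡ (x′ - x) * + a
  b[y-y′]≡ = trans (isolate (+ a) (+ b) x y y′)
    (trans (cong (λ t → t - + a * x - + b * y′) eq) (collect (+ a) (+ b) x x′ y′))

combination-cancelˡ : ∀ {a} {{_ : ℕ.NonZero a}} x x′ {t} → + a * x + t ≡ + a * x′ + t → x ≡ x′
combination-cancelˡ {a} x x′ {t} eq =
  ℤ.*-cancelˡ-≡ (+ a) x x′ (+-cancelʳ t (+ a * x) (+ a * x′) eq)

length-cartesianProductWith : ∀ {A B C : Set} (f : A → B → C) xs ys →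
  length (cartesianProductWith f xs ys) ≡ length xs ℕ.* length ys
length-cartesianProductWith f []       ys = refl
length-cartesianProductWith f (x ∷ xs) ys =
  trans (length-++ (map (f x) ys))
    (cong₂ ℕ._+_ (length-map (f x) ys) (length-cartesianProductWith f xs ys))

-- a₁ = 0 would force a₂ = 1, a minimal generator of any semigroup containing it.
gluing⇒a₁-nonZero : ∀ {Γ Γ₁ Γ₂ a₁ a₂} → IsGluing Γ a₁ Γ₁ a₂ Γ₂ → ℕ.NonZero a₁
gluing⇒a₁-nonZero {Γ₁ = Γ₁} {a₂ = a₂} gluing = ℕ.≢-nonZero λ a₁≡0 →
  let a₂≡1 = Coprimality.0-coprimeTo-m⇒m≡1
               (Coprimality.gcd≡1⇒coprime (subst (λ a → gcd a a₂ ≡ 1) a₁≡0 gcd≡1))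
  in a₂-not-minimal (subst (λ n → IsMinimalGenerator n Γ₁) (sym a₂≡1)
       (1-minimalGenerator (numerical⇒cofinite semigroup₁)
         (subst (λ n → + n ∈ Γ₁) a₂≡1 a₂∈Γ₁)))
  where open IsGluing gluing

module _ {Γ Γ₁ Γ₂ : ℤSet} {a₁ a₂ : ℕ} {{_ : ℕ.NonZero a₁}}
  (is₁ : IsCofiniteSubmonoid Γ₁) (is₂ : IsCofiniteSubmonoid Γ₂)
  (a₁∈Γ₂ : + a₁ ∈ Γ₂) (a₂∈Γ₁ : + a₂ ∈ Γ₁) (gcd≡1 : gcd a₁ a₂ ≡ 1)
  (Γ≐ : Γ ≐ + a₁ ⊙ Γ₁ ⊕ + a₂ ⊙ Γ₂) where

  private
    module Γ₁ = IsCofiniteSubmonoid is₁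

  combination-∈ : ∀ {x y} → x ∈ Γ₁ → y ∈ Γ₂ → + a₁ * x + + a₂ * y ∈ Γ
  combination-∈ x∈ y∈ = proj₂ Γ≐ (_ , _ , (_ , x∈ , refl) , (_ , y∈ , refl) , refl)

  Ap-gluing : ∀ z → Ap Γ (+ a₁ * z) ≐ + a₁ ⊙ Ap Γ₁ z ⊕ + a₂ ⊙ Ap Γ₂ (+ a₁)
  Ap-gluing z = to , from
    where
    shift : ∀ a₁ a₂ s w k → a₁ * s + a₂ * (w + k * a₁) ≡ a₁ * (s + k * a₂) + a₂ * w
    shift = solve-∀
    subtract-z : ∀ a₁ a₂ x w z → a₁ * (x - z) + a₂ * w ≡ a₁ * x + a₂ * w - a₁ * z
    subtract-z = solve-∀

    to : Ap Γ (+ a₁ * z) ⊆ + a₁ ⊙ Ap Γ₁ z ⊕ + a₂ ⊙ Ap Γ₂ (+ a₁)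
    to (γ∈ , γ-a₁z∉) with proj₁ Γ≐ γ∈
    ... | _ , _ , (s , s∈ , refl) , (t , t∈ , refl) , refl
      -- The excess `a₂ * (k * a₁)` moves to the first summand as `a₁ * (k * a₂)`, which is allowed
      -- since `a₂` lies in `Γ₁`.
      with w , w∈ , k , refl ← Ap-decompose is₂ a₁ t∈ =
      _ , _ , (s + + k * + a₂ , (Γ₁.+-closed s∈ (Γ₁.*-closed k a₂∈Γ₁) , x-z∉) , refl) ,
      (w , w∈ , refl) , shift (+ a₁) (+ a₂) s w (+ k)
      where
      x = s + + k * + a₂
      x-z∉ : x - z ∉ Γ₁
      x-z∉ x-z∈ = γ-a₁z∉ (subst Γ
        (trans (subtract-z (+ a₁) (+ a₂) x w z)
          (cong (_- + a₁ * z) (sym (shift (+ a₁) (+ a₂) s w (+ k)))))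
        (combination-∈ x-z∈ (proj₁ w∈)))

    from : + a₁ ⊙ Ap Γ₁ z ⊕ + a₂ ⊙ Ap Γ₂ (+ a₁) ⊆ Ap Γ (+ a₁ * z)
    from (_ , _ , (x , (x∈ , x-z∉) , refl) , (w , w∈ , refl) , refl) =
      combination-∈ x∈ (proj₁ w∈) , γ-a₁z∉
      where
      γ-a₁z∉ : + a₁ * x + + a₂ * w - + a₁ * z ∉ Γ
      γ-a₁z∉ γ-a₁z∈ with proj₁ Γ≐ γ-a₁z∈
      ... | _ , _ , (s , s∈ , refl) , (t , t∈ , refl) , eq =
        -- Comparing `a₁ * (x - z) + a₂ * w` with `a₁ * s + a₂ * t` makes `w` and `t` congruent
        -- modulo `a₁`. Then `t ≡ w + k * a₁` with `k` natural, and cancelling leaves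
        -- `x - z ≡ s + k * a₂`, an element of `Γ₁`.
        x-z∉ (x-z∈ (Ap-least is₂ a₁ a₁∈Γ₂ w∈ t∈
          (combination-≡⇒∣ {a₁} {a₂} gcd≡1 {x - z} {s} {w} {t} eq′)))
        where
        eq′ : + a₁ * (x - z) + + a₂ * w ≡ + a₁ * s + + a₂ * t
        eq′ = trans (subtract-z (+ a₁) (+ a₂) x w z) eq
        x-z∈ : (∃ λ k → t ≡ w + + k * + a₁) → x - z ∈ Γ₁
        x-z∈ (k , t≡) = subst Γ₁ (sym x-z≡) (Γ₁.+-closed s∈ (Γ₁.*-closed k a₂∈Γ₁))
          where
          x-z≡ : x - z ≡ s + + k * + a₂
          x-z≡ = combination-cancelˡ (x - z) (s + + k * + a₂) {+ a₂ * w}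
            (trans eq′ (trans (cong (λ t → + a₁ * s + + a₂ * t) t≡)
              (shift (+ a₁) (+ a₂) s w (+ k))))

  Ap-gluing-cardinality : ApResidueSystem Γ₂ a₁ → ∀ z {n} → HasCardinality (Ap Γ₁ z) n →
    HasCardinality (Ap Γ (+ a₁ * z)) (a₁ ℕ.* n)
  Ap-gluing-cardinality (w , w∈ , w-injective , w-surjective) z (xs , xs! , (⊆xs , xs⊆) , refl) =
    cartesianProductWith f xs is ,
    Unique.cartesianProductWith⁺ f f-injective xs! (Unique.allFin⁺ a₁) ,
    (to , from) ,
    trans (length-cartesianProductWith f xs is)
      (trans (cong (length xs ℕ.*_) (length-tabulate id)) (ℕ.*-comm (length xs) a₁))
    where
    is = allFin a₁
    f : ℤ → Fin a₁ → ℤ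
    f x i = + a₁ * x + + a₂ * w i

    cancel-same-index : ∀ {x y i j} → f x i ≡ f y j → i ≡ j → x ≡ y × i ≡ j
    cancel-same-index {x} {y} eq refl = combination-cancelˡ x y eq , refl

    -- The congruence modulo `a₁` identifies the indices first; only then is the second summand
    -- common and can be cancelled.
    f-injective : ∀ {x y i j} → f x i ≡ f y j → x ≡ y × i ≡ j
    f-injective {x} {y} eq =
      cancel-same-index eq (w-injective (combination-≡⇒∣ {a₁} {a₂} gcd≡1 {x} {y} eq))

    to : Ap Γ (+ a₁ * z) ⊆ (_∈ˡ cartesianProductWith f xs is)
    to γ∈ with proj₁ (Ap-gluing z) γ∈
    ... | _ , _ , (x , x∈ , refl) , (y , y∈ , refl) , refl
      with i , refl ← w-surjective y∈ = ∈-cartesianProductWith⁺ f (⊆xs x∈) (∈-allFin i)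

    from : ∀ {γ} → γ ∈ˡ cartesianProductWith f xs is → γ ∈ Ap Γ (+ a₁ * z)
    from γ∈ with x , i , x∈ , _ , refl ← ∈-cartesianProductWith⁻ f xs is γ∈ =
      proj₂ (Ap-gluing z) (_ , _ , (x , xs⊆ x∈ , refl) , (w i , w∈ i , refl) , refl)

-- The cardinality claim asserts an actual `n`, so the finiteness of both Apéry sets is part of the
-- conclusion.
proposition10 : (Γ Γ₁ Γ₂ : ℤSet) (a₁ a₂ : ℕ) → IsGluing Γ a₁ Γ₁ a₂ Γ₂ → (z : ℤ) →
    (Ap Γ (+ a₁ * z) ≐ + a₁ ⊙ Ap Γ₁ z ⊕ + a₂ ⊙ Ap Γ₂ (+ a₁))
    × (∃ λ n → HasCardinality (Ap Γ₁ z) n × HasCardinality (Ap Γ (+ a₁ * z)) (a₁ ℕ.* n))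
proposition10 Γ Γ₁ Γ₂ a₁ a₂ gluing z =
  Ap-gluing is₁ is₂ a₁∈Γ₂ a₂∈Γ₁ gcd≡1 Γ≐ z , n , finite ,
  Ap-gluing-cardinality is₁ is₂ a₁∈Γ₂ a₂∈Γ₁ gcd≡1 Γ≐ (Ap-residues is₂ a₁ a₁∈Γ₂) z finite
  where
  open IsGluing gluing
  instance _ = gluing⇒a₁-nonZero gluing
  is₁ = numerical⇒cofinite semigroup₁
  is₂ = numerical⇒cofinite semigroup₂
  n = proj₁ (Ap-finite is₁ z)
  finite = proj₂ (Ap-finite is₁ z)
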